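{- Let $G=(V,E)$ be a hedgegraph and $k$ a positive integer. Then $E$ can be partitioned into $k$ acyclic-trimmable subsets if and only if $|E[\mathcal{P}]|\le k(|V|-|\mathcal{P}|)$ for every partition $\mathcal{P}$ of $V$.
   Context: A hedgegraph $G=(V,E)$ consists of a finite vertex set $V$ and a finite set $E$ of hedges; each hedge is a set of hyperedges (subsets of $V$), the hyperedges within one hedge are pairwise vertex-disjoint, and no hyperedge belongs to two hedges. For a partition $\mathcal{P}$ of $V$ into nonempty parts, $\delta(\mathcal{P})$ is the set of hedges containing a hyperedge that intersects at least two parts of $\mathcal{P}$, and $E[\mathcal{P}]:=E\setminus\delta(\mathcal{P})$. A trimming of a hedge $e$ chooses one hyperedge $h\in e$ and two distinct vertices $u,v\in h$ and replaces $e$ by the single edge $\{u,v\}$; a trimming of a set $F$ of hedges trims every hedge of $F$, yielding a multigraph on $V$ with $|F|$ edges. A set $F$ of hedges is acyclic-trimmable if it has a trimming that is a forest (acyclic multigraph). -}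

module Defs where

open import Data.Nat using (ℕ; suc)
open import Data.Fin using (Fin; zero; suc; inject₁; fromℕ; _≟_)
open import Data.Fin.Properties using (any?)
open import Data.Fin.Subset using (Subset; _∩_; Empty) renaming (_∈_ to _∈ₛ_)
open import Data.Fin.Subset.Properties using (_∈?_)
open import Data.List using (List; length; filter; allFin)
open import Data.List.Membership.Propositional using (_∈_)
open import Data.List.Relation.Unary.Any using (Any)
import Data.List.Relation.Unary.Any as Any
open import Data.List.Relation.Unary.AllPairs using (AllPairs)
open import Data.Product using (Σ; ∃; _×_; _,_; proj₁; proj₂)
open import Data.Sum using (_⊎_)
open import Relation.Binary.PropositionalEquality using (_≡_; _≢_)
open import Relation.Nullary using (¬_; Dec)
open import Relation.Nullary.Decidable using (_×-dec_; ¬?)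
open import Function.Definitions using (Injective)

-- Hedgegraphs
-- Vertex set V = Fin n, hedge set E indexed by Fin m.
-- A hyperedge is a subset of V; a hedge is a finite set (list) of hyperedges.

Hyperedge : ℕ → Set
Hyperedge n = Subset n

Disjoint : ∀ {n} → Subset n → Subset n → Set
Disjoint p q = Empty (p ∩ q)

record Hedgegraph (n m : ℕ) : Set where
  field
    hedge    : Fin m → List (Hyperedge n)
    disjoint : ∀ e → AllPairs Disjoint (hedge e)
    unique   : ∀ e e' h → e ≢ e' → h ∈ hedge e → ¬ (h ∈ hedge e')
open Hedgegraph public

-- Partitions of V into nonempty parts: a surjective labelling
-- p : Fin n → Fin r ; the parts are the fibres, |P| = r.

IsPartition : ∀ {n r} → (Fin n → Fin r) → Set
IsPartition {r = r} p = ∀ (b : Fin r) → ∃ λ u → p u ≡ b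

Crosses : ∀ {n r} → (Fin n → Fin r) → Subset n → Set
Crosses p h = ∃ λ u → ∃ λ v → u ∈ₛ h × v ∈ₛ h × p u ≢ p v

crosses? : ∀ {n r} (p : Fin n → Fin r) (h : Subset n) → Dec (Crosses p h)
crosses? p h = any? λ u → any? λ v → (u ∈? h) ×-dec ((v ∈? h) ×-dec ¬? (p u ≟ p v))

InDelta : ∀ {n m r} → Hedgegraph n m → (Fin n → Fin r) → Fin m → Set
InDelta G p e = Any (Crosses p) (hedge G e)

inDelta? : ∀ {n m r} (G : Hedgegraph n m) (p : Fin n → Fin r) (e : Fin m) → Dec (InDelta G p e)
inDelta? G p e = Any.any? (crosses? p) (hedge G e)

sizeEP : ∀ {n m r} → Hedgegraph n m → (Fin n → Fin r) → ℕ
sizeEP {m = m} G p = length (filter (λ e → ¬? (inDelta? G p e)) (allFin m))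

record Multigraph (n : ℕ) : Set₁ where
  field
    Edge : Set
    ends : Edge → Fin n × Fin n
open Multigraph public

Joins : ∀ {n} → Fin n × Fin n → Fin n → Fin n → Set
Joins (a , b) x y = (a ≡ x × b ≡ y) ⊎ (a ≡ y × b ≡ x)

-- A cycle of length L = suc l: closed walk v₀ e₀ v₁ … e_l v_{L} with
-- v_L = v₀, vertices v₀ … v_{L-1} distinct and edges e₀ … e_l distinct.
-- (Length 1 = loop, length 2 = pair of parallel edges.)
record Cycle {n : ℕ} (M : Multigraph n) : Set where
  field
    l     : ℕ
    vert  : Fin (suc (suc l)) → Fin n
    edge  : Fin (suc l) → Edge M
    closed    : vert (fromℕ (suc l)) ≡ vert zero
    vertDistinct : Injective _≡_ _≡_ (λ i → vert (inject₁ i))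
    edgeDistinct : Injective _≡_ _≡_ edge
    joins : ∀ i → Joins (ends M (edge i)) (vert (inject₁ i)) (vert (suc i))

Forest : ∀ {n} → Multigraph n → Set
Forest M = ¬ Cycle M

Trimming : ∀ {n} → List (Hyperedge n) → Set
Trimming {n} e = Σ (Hyperedge n) λ h → h ∈ e ×
                   Σ (Fin n × Fin n) λ { (u , v) → u ≢ v × u ∈ₛ h × v ∈ₛ h }

trimmed : ∀ {n m} (G : Hedgegraph n m) (F : Fin m → Set) →
          ((e : Fin m) → F e → Trimming (hedge G e)) → Multigraph n
trimmed {n} {m} G F t = record
  { Edge = Σ (Fin m) F
  ; ends = λ { (e , fe) → proj₁ (proj₂ (proj₂ (t e fe))) }
  }

AcyclicTrimmable : ∀ {n m} → Hedgegraph n m → (Fin m → Set) → Set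
AcyclicTrimmable G F =
  Σ ((e : _) → F e → Trimming (hedge G e)) λ t → Forest (trimmed G F t)

-- E partitioned into k (possibly empty) subsets, given by a labelling c : Fin m → Fin k,
-- each class acyclic-trimmable
PartitionableInto : ∀ {n m} → Hedgegraph n m → ℕ → Set
PartitionableInto {m = m} G k =
  Σ (Fin m → Fin k) λ c → ∀ (j : Fin k) → AcyclicTrimmable G (λ e → c e ≡ j)

{-# OPTIONS --safe #-}

-- Trimming E into k forests amounts to choosing, for every hedge, an edge inside one of its
-- hyperedges in one of k disjoint copies of V, so that the chosen edges form a forest. This is
-- Rado's theorem on independent transversals for the graphic matroid of the k copies, whose
-- condition says that, for every partition of the k n vertices, the number of hedges with all
-- their edges inside parts is at most k n minus the number of parts. If every copy of V gets
-- the partition induced on it, one that induces the most parts gives the condition from the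
-- hypothesis. Rado's theorem is proved by deleting candidate edges while keeping the
-- condition: if neither of two candidates of a hedge could be deleted, the join and the meet
-- of the two violated partitions would contradict semimodularity of the partition lattice.
-- With one edge left per hedge, a cycle would violate the condition when it is collapsed.
-- Conversely, the edges of a forest inside the parts of P number at most |V| - |P|, since
-- their connected components refine P.

module Submission where

open import Defs
open import Algebra.Properties.CommutativeSemigroup using (interchange)
open import Level using (0ℓ)
open import Data.Nat using (ℕ; zero; suc; _+_; _≤_; _<_; _*_; _∸_; z≤n; s≤s; s≤s⁻¹; _<?_)
open import Data.Nat.Properties hiding (_≟_; suc-injective)
open import Data.Fin using (Fin; zero; suc; _≟_; inject₁; fromℕ; toℕ; punchIn; punchOut; combine; inject≤; fromℕ<)
open import Data.Fin.Properties using (any?; all?; punchOut-injective; punchOut-cong; punchOut-punchIn; punchInᵢ≢i; injective⇒≤; combine-injectiveˡ; combine-injectiveʳ; combine-surjective; suc-injective; toℕ-injective; fromℕ≢inject₁; inject₁-injective; inject≤-injective; toℕ<n; toℕ-fromℕ<)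
open import Data.Fin.Relation.Unary.Top using (view; ‵fromℕ; ‵inject₁)
open import Data.Fin.Subset.Properties using (_∈?_)
open import Data.List using (List; []; _∷_; [_]; length; filter; tabulate; allFin; lookup; concatMap; map; _++_; cartesianProduct)
open import Data.List.Membership.Propositional using (_∈_; lose)
open import Data.List.Membership.Propositional.Properties using (∈-filter⁺; ∈-filter⁻; ∈-allFin; ∈-lookup; ∈-map⁺; ∈-++⁺ˡ; ∈-++⁺ʳ; ∈-concatMap⁺; ∈-cartesianProduct⁺)
import Data.List.Membership.Setoid.Properties as Membership
open import Data.List.Relation.Unary.All as All using (All; []; _∷_)
open import Data.List.Relation.Unary.AllPairs using ([]; _∷_)
open import Data.List.Relation.Unary.Any as Any using (Any; here; there)
open import Data.List.Relation.Unary.Unique.Propositional using (Unique)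
import Data.List.Relation.Unary.Unique.Propositional.Properties as Unique
open import Data.Product using (Σ; ∃; ∃₂; _×_; _,_; proj₁; proj₂)
open import Data.Sum using (inj₁; inj₂; _⊎_)
open import Data.Unit using (⊤; tt)
open import Data.Empty using (⊥; ⊥-elim)
import Data.Vec.Functional as Vector
open import Function using (_∘_; id; mk⇔)
open import Function.Bundles using (_⇔_)
open import Function.Definitions using (Injective)
open import Relation.Binary using (Rel; IsEquivalence)
open import Relation.Binary.Construct.Closure.ReflexiveTransitive as Star using (Star; ε; _◅_; _◅◅_)
import Relation.Binary.Construct.On as On
open import Relation.Binary.PropositionalEquality using (_≡_; _≢_; refl; sym; trans; cong; cong₂; subst; setoid; isEquivalence)
open import Relation.Nullary using (¬_; Dec; yes; no; contradiction)
open import Relation.Nullary.Decidable using (_×-dec_; ¬?; map′; decidable-stable)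
open import Relation.Unary using (Pred; Decidable)

-- Partitions

infix 4 _⊑_

-- Refinement is inclusion of kernels, so it also compares labellings that have different codomains
-- or are not onto.
_⊑_ : ∀ {n r} {A : Set} → (Fin n → Fin r) → (Fin n → A) → Set
p ⊑ q = ∀ {x y} → p x ≡ p y → q x ≡ q y

-- Representatives of different parts of `q` lie in different parts of `p`.
coarser⇒fewerParts : ∀ {n r s} (p : Fin n → Fin r) (q : Fin n → Fin s) →
                     IsPartition q → p ⊑ q → s ≤ r
coarser⇒fewerParts p q onto p⊑q = injective⇒≤ {f = p ∘ rep} λ {b} {c} eq →
  trans (sym (proj₂ (onto b))) (trans (p⊑q eq) (proj₂ (onto c)))
  where
  rep : _ → _
  rep b = proj₁ (onto b)

-- The field `finest` is the universal property of the join with the pair `x`, `y`. It ranges over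
-- arbitrary equivalences so that it applies both to kernels of partitions and to connectivity in a
-- graph.
record Merge {n r : ℕ} (p : Fin n → Fin r) (x y : Fin n) : Set₁ where
  field
    size      : ℕ
    label     : Fin n → Fin size
    partition : IsPartition label
    coarser   : p ⊑ label
    joined    : label x ≡ label y
    finest    : ∀ {R : Rel (Fin n) 0ℓ} → IsEquivalence R →
                (∀ {s t} → p s ≡ p t → R s t) → R x y →
                ∀ {s t} → label s ≡ label t → R s t
    size≥     : r ≤ suc size
    size<     : p x ≢ p y → suc size ≤ r

merge : ∀ {n r} (p : Fin n → Fin r) → IsPartition p → ∀ x y → Merge p x y
merge {n} {zero} p onto x y with () ← p x
merge {n} {suc r} p onto x y with p x ≟ p y
... | yes px≡py = record
  { size = suc r ; label = p ; partition = onto ; coarser = id ; joined = px≡py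
  ; finest = λ _ p⊑R _ → p⊑R ; size≥ = n≤1+n _ ; size< = contradiction px≡py }
... | no px≢py = record
  { size = r ; label = q ; partition = q-onto
  ; coarser = q-coarser
  ; joined = punchOut-cong (p x) (trans moved-x (sym moved-y))
  ; finest = finest ; size≥ = ≤-refl ; size< = λ _ → ≤-refl }
  where
  -- The part of `x` is redirected to that of `y`, so the label `p x` becomes free and `punchOut`
  -- removes it.
  moved : Fin n → Fin n
  moved s with p s ≟ p x
  ... | yes _ = y
  ... | no  _ = s

  avoids : ∀ s → p x ≢ p (moved s)
  avoids s with p s ≟ p x
  ... | yes _ = px≢py
  ... | no ps≢px = ps≢px ∘ sym

  moved-cong : ∀ {s t} → p s ≡ p t → p (moved s) ≡ p (moved t)
  moved-cong {s} {t} eq with p s ≟ p x | p t ≟ p x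
  ... | yes _ | yes _ = refl
  ... | no  _ | no  _ = eq
  ... | yes a | no  b = contradiction (trans (sym eq) a) b
  ... | no  a | yes b = contradiction (trans eq b) a

  moved-id : ∀ {s} → p s ≢ p x → p (moved s) ≡ p s
  moved-id {s} ps≢px with p s ≟ p x
  ... | yes a = contradiction a ps≢px
  ... | no  _ = refl

  moved-x : p (moved x) ≡ p y
  moved-x with p x ≟ p x
  ... | yes _ = refl
  ... | no  a = contradiction refl a

  moved-y : p (moved y) ≡ p y
  moved-y = moved-id (px≢py ∘ sym)

  q : Fin n → Fin r
  q s = punchOut (avoids s)

  q-coarser : p ⊑ q
  q-coarser eq = punchOut-cong (p x) (moved-cong eq)

  q-onto : IsPartition q
  q-onto b with onto (punchIn (p x) b)
  ... | s , ps≡ = s , trans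
    (punchOut-cong (p x) {i≢k = punchInᵢ≢i (p x) b ∘ sym}
      (trans (moved-id (λ ps≡px → punchInᵢ≢i (p x) b (trans (sym ps≡) ps≡px))) ps≡))
    (punchOut-punchIn (p x))

  finest : ∀ {R : Rel (Fin n) 0ℓ} → IsEquivalence R →
           (∀ {s t} → p s ≡ p t → R s t) → R x y →
           ∀ {s t} → q s ≡ q t → R s t
  finest {R} equiv p⊑R Rxy {s} {t} eq =
    R.trans (R-moved s) (R.trans (p⊑R (punchOut-injective (avoids s) (avoids t) eq))
                                 (R.sym (R-moved t)))
    where
    module R = IsEquivalence equiv
    R-moved : ∀ s → R s (moved s)
    R-moved s with p s ≟ p x
    ... | yes ps≡px = R.trans (p⊑R ps≡px) Rxy
    ... | no  _     = R.refl

kernel-isEquivalence : ∀ {n r} (q : Fin n → Fin r) → IsEquivalence (λ s t → q s ≡ q t)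
kernel-isEquivalence q = On.isEquivalence q isEquivalence

-- Induction on the points: the first one joins the class of a later point with the same label, or
-- else opens a new class. This makes a partition out of any labelling, such as the restriction of a
-- partition to one copy of `V`.
quotient : ∀ {n M} (f : Fin n → Fin M) →
           ∃₂ λ r (p : Fin n → Fin r) → IsPartition p × f ⊑ p × p ⊑ f
quotient {zero} f = 0 , (λ ()) , (λ ()) , (λ { {()} }) , (λ { {()} })
quotient {suc n} f with quotient (f ∘ suc) | any? (λ y → f (suc y) ≟ f zero)
... | r , p , onto , f⊑p , p⊑f | yes (y , fy≡f0) =
  r , q , q-onto , (λ {s} {t} → f⊑q s t) , λ {s} {t} → q⊑f s t
  where
  lower : Fin (suc n) → Fin n
  lower zero    = y
  lower (suc s) = s
  f-lower : ∀ s → f (suc (lower s)) ≡ f s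
  f-lower zero    = fy≡f0
  f-lower (suc s) = refl
  q : Fin (suc n) → Fin r
  q = p ∘ lower
  q-onto : IsPartition q
  q-onto b = suc (proj₁ (onto b)) , proj₂ (onto b)
  f⊑q : ∀ s t → f s ≡ f t → q s ≡ q t
  f⊑q s t eq = f⊑p (trans (f-lower s) (trans eq (sym (f-lower t))))
  q⊑f : ∀ s t → q s ≡ q t → f s ≡ f t
  q⊑f s t eq = trans (sym (f-lower s)) (trans (p⊑f eq) (f-lower t))
... | r , p , onto , f⊑p , p⊑f | no new =
  suc r , q , q-onto , (λ {s} {t} → f⊑q s t) , λ {s} {t} → q⊑f s t
  where
  q : Fin (suc n) → Fin (suc r)
  q zero    = zero
  q (suc s) = suc (p s)
  q-onto : IsPartition q
  q-onto zero    = zero , refl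
  q-onto (suc b) = suc (proj₁ (onto b)) , cong suc (proj₂ (onto b))
  f⊑q : ∀ s t → f s ≡ f t → q s ≡ q t
  f⊑q zero    zero    _  = refl
  f⊑q zero    (suc t) eq = contradiction (t , sym eq) new
  f⊑q (suc s) zero    eq = contradiction (s , eq) new
  f⊑q (suc s) (suc t) eq = cong suc (f⊑p eq)
  q⊑f : ∀ s t → q s ≡ q t → f s ≡ f t
  q⊑f zero    zero    _  = refl
  q⊑f (suc s) (suc t) eq = p⊑f (suc-injective eq)

-- The paired label has the intersection of both kernels as its kernel; `quotient` discards the
-- pairs that do not occur.
meet : ∀ {n a b} (p : Fin n → Fin a) (q : Fin n → Fin b) →
       ∃₂ λ c (h : Fin n → Fin c) → IsPartition h × h ⊑ p × h ⊑ q ×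
         (∀ {x y} → p x ≡ p y → q x ≡ q y → h x ≡ h y)
meet p q with quotient (λ x → combine (p x) (q x))
... | c , h , onto , pq⊑h , h⊑pq = c , h , onto ,
  (λ {x} {y} eq → combine-injectiveˡ (p x) (q x) (p y) (q y) (h⊑pq eq)) ,
  (λ {x} {y} eq → combine-injectiveʳ (p x) (q x) (p y) (q y) (h⊑pq eq)) ,
  λ eq₁ eq₂ → pq⊑h (cong₂ combine eq₁ eq₂)

-- Merging two parts of a refinement of p and q that lie in one part of p
-- decreases the size of the refinement by one and that of q by at most one.
semimodular : ∀ {n a b c} fuel → c ≤ fuel →
  (p : Fin n → Fin a) → IsPartition p → (q : Fin n → Fin b) → IsPartition q →
  (h : Fin n → Fin c) → IsPartition h → h ⊑ p → h ⊑ q →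
  ∃₂ λ d (j : Fin n → Fin d) → IsPartition j × p ⊑ j × q ⊑ j × a + b ≤ c + d
semimodular {n} {a} {b} {c} fuel c≤fuel p p-onto q q-onto h h-onto h⊑p h⊑q
  with any? (λ x → any? (λ y → (p x ≟ p y) ×-dec ¬? (h x ≟ h y)))
-- Now `p` and `h` have the same kernel, so `p` refines `q` and `q` itself is the join.
... | no none = b , q , q-onto , h⊑q ∘ p⊑h , id ,
      +-monoˡ-≤ b (coarser⇒fewerParts h p p-onto h⊑p)
  where
  p⊑h : p ⊑ h
  p⊑h {x} {y} eq = decidable-stable (h x ≟ h y) λ hx≢hy → none (x , y , eq , hx≢hy)
... | yes (x , y , px≡py , hx≢hy) = step fuel c≤fuel
  where
  module h′ = Merge (merge h h-onto x y)
  module q′ = Merge (merge q q-onto x y)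
  step : ∀ fuel → c ≤ fuel →
         ∃₂ λ d (j : Fin n → Fin d) → IsPartition j × p ⊑ j × q ⊑ j × a + b ≤ c + d
  step zero    c≤0 = contradiction (≤-trans (h′.size< hx≢hy) c≤0) λ ()
  step (suc fuel) c≤fuel
    with semimodular fuel (s≤s⁻¹ (≤-trans (h′.size< hx≢hy) c≤fuel)) p p-onto
           q′.label q′.partition h′.label h′.partition
           (h′.finest (kernel-isEquivalence p) h⊑p px≡py)
           (h′.finest (kernel-isEquivalence q′.label) (q′.coarser ∘ h⊑q) q′.joined)
  ... | d , j , j-onto , p⊑j , q′⊑j , le = d , j , j-onto , p⊑j , q′⊑j ∘ q′.coarser , (begin
      a + b              ≤⟨ +-monoʳ-≤ a q′.size≥ ⟩
      a + suc q′.size    ≡⟨ +-suc a q′.size ⟩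
      suc (a + q′.size)  ≤⟨ s≤s le ⟩
      suc h′.size + d    ≤⟨ +-monoˡ-≤ d (h′.size< hx≢hy) ⟩
      c + d              ∎)
    where open ≤-Reasoning

-- Starting from the discrete partition, each of the `l` merges costs at most one part.
collapse : ∀ {N} l (w : Fin (suc l) → Fin N) →
           ∃₂ λ r (p : Fin N → Fin r) → IsPartition p × N ≤ l + r × (∀ i → p (w i) ≡ p (w zero))
collapse {N} zero    w = N , id , (λ b → b , refl) , ≤-refl , λ { zero → refl }
collapse {N} (suc l) w with collapse l (w ∘ suc)
... | r , p , onto , N≤ , same = q.size , q.label , q.partition ,
  ≤-trans N≤ (≤-trans (+-monoʳ-≤ l q.size≥) (≤-reflexive (+-suc l q.size))) ,
  λ { zero → refl ; (suc i) → trans (q.coarser (same i)) (sym q.joined) }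
  where module q = Merge (merge p onto (w zero) (w (suc zero)))

-- Counting

bit : {P : Set} → Dec P → ℕ
bit (yes _) = 1
bit (no  _) = 0

count : ∀ {m} {P : Pred (Fin m) 0ℓ} → Decidable P → ℕ
count {zero}  P? = 0
count {suc m} P? = bit (P? zero) + count (P? ∘ suc)

length-filter-tabulate : ∀ {m} {A : Set} {P : Pred A 0ℓ} (P? : Decidable P) (f : Fin m → A) →
                         length (filter P? (tabulate f)) ≡ count (P? ∘ f)
length-filter-tabulate {zero}  P? f = refl
length-filter-tabulate {suc m} P? f with P? (f zero)
... | yes _ = cong suc (length-filter-tabulate P? (f ∘ suc))
... | no  _ = length-filter-tabulate P? (f ∘ suc)

length-filter-allFin : ∀ {m} {P : Pred (Fin m) 0ℓ} (P? : Decidable P) →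
                       length (filter P? (allFin m)) ≡ count P?
length-filter-allFin P? = length-filter-tabulate P? id

bit-submodular : {X Y Z W : Set} (x : Dec X) (y : Dec Y) (z : Dec Z) (w : Dec W) →
                 (X → Z) → (Y → Z) → (X → Y → W) → bit x + bit y ≤ bit z + bit w
bit-submodular (yes a) _       (no ¬c) _       X⇒Z Y⇒Z XY⇒W = contradiction (X⇒Z a) ¬c
bit-submodular (no  _) (yes b) (no ¬c) _       X⇒Z Y⇒Z XY⇒W = contradiction (Y⇒Z b) ¬c
bit-submodular (yes a) (yes b) (yes _) (no ¬d) X⇒Z Y⇒Z XY⇒W = contradiction (XY⇒W a b) ¬d
bit-submodular (yes _) (yes _) (yes _) (yes _) X⇒Z Y⇒Z XY⇒W = ≤-refl
bit-submodular (yes _) (no  _) (yes _) _       X⇒Z Y⇒Z XY⇒W = s≤s z≤n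
bit-submodular (no  _) (yes _) (yes _) _       X⇒Z Y⇒Z XY⇒W = s≤s z≤n
bit-submodular (no  _) (no  _) _       _       X⇒Z Y⇒Z XY⇒W = z≤n

bit-exchange : {X Y Z W : Set} (x : Dec X) (y : Dec Y) (z : Dec Z) (w : Dec W) →
               (X → Y → Z) → bit x + bit y ≤ suc (bit z + bit w)
bit-exchange (yes a) (yes b) (no ¬c) _ XY⇒Z = contradiction (XY⇒Z a b) ¬c
bit-exchange (yes _) (yes _) (yes _) _ XY⇒Z = s≤s (s≤s z≤n)
bit-exchange (yes _) (no  _) _       _ XY⇒Z = s≤s z≤n
bit-exchange (no  _) (yes _) _       _ XY⇒Z = s≤s z≤n
bit-exchange (no  _) (no  _) _       _ XY⇒Z = z≤n

+-mono-interchange : ∀ x x′ y y′ z z′ w w′ → x + y ≤ z + w → x′ + y′ ≤ z′ + w′ →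
                     (x + x′) + (y + y′) ≤ (z + z′) + (w + w′)
+-mono-interchange x x′ y y′ z z′ w w′ le le′ = begin
  (x + x′) + (y + y′) ≡⟨ interchange +-commutativeSemigroup x x′ y y′ ⟩
  (x + y) + (x′ + y′) ≤⟨ +-mono-≤ le le′ ⟩
  (z + w) + (z′ + w′) ≡⟨ interchange +-commutativeSemigroup z w z′ w′ ⟩
  (z + z′) + (w + w′) ∎
  where open ≤-Reasoning

-- This is |X| + |Y| = |X ∪ Y| + |X ∩ Y|, checked index by index. In the application `X` and `Y` are
-- the hedges inside two partitions, `Z` those inside the join and `W` those inside the meet.
count-submodular : ∀ {m} {X Y Z W : Pred (Fin m) 0ℓ}
  (X? : Decidable X) (Y? : Decidable Y) (Z? : Decidable Z) (W? : Decidable W) →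
  (∀ i → X i → Z i) → (∀ i → Y i → Z i) → (∀ i → X i → Y i → W i) →
  count X? + count Y? ≤ count Z? + count W?
count-submodular {zero}  X? Y? Z? W? X⇒Z Y⇒Z XY⇒W = z≤n
count-submodular {suc m} X? Y? Z? W? X⇒Z Y⇒Z XY⇒W =
  +-mono-interchange (bit (X? zero)) _ (bit (Y? zero)) _ (bit (Z? zero)) _ (bit (W? zero)) _
    (bit-submodular (X? zero) (Y? zero) (Z? zero) (W? zero) (X⇒Z zero) (Y⇒Z zero) (XY⇒W zero))
    (count-submodular (X? ∘ suc) (Y? ∘ suc) (Z? ∘ suc) (W? ∘ suc)
      (X⇒Z ∘ suc) (Y⇒Z ∘ suc) (XY⇒W ∘ suc))

-- At the exceptional index `e` nothing is known about `W`, and `Z` is known only when both `X` and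
-- `Y` hold. There the left side can exceed the right by at most one, which is the `suc`.
count-exchange : ∀ {m} {X Y Z W : Pred (Fin m) 0ℓ}
  (X? : Decidable X) (Y? : Decidable Y) (Z? : Decidable Z) (W? : Decidable W) (e : Fin m) →
  (∀ i → i ≢ e → X i → Z i) → (∀ i → i ≢ e → Y i → Z i) →
  (∀ i → i ≢ e → X i → Y i → W i) → (X e → Y e → Z e) →
  count X? + count Y? ≤ suc (count Z? + count W?)
count-exchange {suc m} X? Y? Z? W? zero X⇒Z Y⇒Z XY⇒W XY⇒Z =
  +-mono-interchange (bit (X? zero)) _ (bit (Y? zero)) _ (suc (bit (Z? zero))) _ (bit (W? zero)) _
    (bit-exchange (X? zero) (Y? zero) (Z? zero) (W? zero) XY⇒Z)
    (count-submodular (X? ∘ suc) (Y? ∘ suc) (Z? ∘ suc) (W? ∘ suc)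
      (λ i → X⇒Z (suc i) λ ()) (λ i → Y⇒Z (suc i) λ ()) (λ i → XY⇒W (suc i) λ ()))
count-exchange {suc m} X? Y? Z? W? (suc e) X⇒Z Y⇒Z XY⇒W XY⇒Z =
  ≤-trans
  (+-mono-interchange (bit (X? zero)) _ (bit (Y? zero)) _ (bit (Z? zero)) (suc (count (Z? ∘ suc))) (bit (W? zero)) _
    (bit-submodular (X? zero) (Y? zero) (Z? zero) (W? zero)
      (X⇒Z zero λ ()) (Y⇒Z zero λ ()) (XY⇒W zero λ ()))
    (count-exchange (X? ∘ suc) (Y? ∘ suc) (Z? ∘ suc) (W? ∘ suc) e
      (λ i i≢e → X⇒Z (suc i) (i≢e ∘ suc-injective)) (λ i i≢e → Y⇒Z (suc i) (i≢e ∘ suc-injective))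
      (λ i i≢e → XY⇒W (suc i) (i≢e ∘ suc-injective)) XY⇒Z))
  (≤-reflexive (cong (_+ count W?) (+-suc (bit (Z? zero)) (count (Z? ∘ suc)))))

count-empty : ∀ {m} {X : Pred (Fin m) 0ℓ} (X? : Decidable X) → (∀ i → ¬ X i) → count X? ≡ 0
count-empty {zero}  X? none = refl
count-empty {suc m} X? none with X? zero
... | yes x = contradiction x (none zero)
... | no  _ = count-empty (X? ∘ suc) (none ∘ suc)

count-∪ : ∀ {m} {X Y Z : Pred (Fin m) 0ℓ}
  (X? : Decidable X) (Y? : Decidable Y) (Z? : Decidable Z) →
  (∀ i → ¬ X i → Z i → Y i) → count Z? ≤ count X? + count Y?
count-∪ {zero}  X? Y? Z? _ = z≤n
count-∪ {suc m} X? Y? Z? Z⇒XY with count-∪ (X? ∘ suc) (Y? ∘ suc) (Z? ∘ suc) (Z⇒XY ∘ suc)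
... | ih with X? zero | Y? zero | Z? zero
... | no ¬x | no ¬y | yes z = contradiction (Z⇒XY zero ¬x z) ¬y
... | yes _ | yes _ | yes _ = s≤s (≤-trans ih (+-monoʳ-≤ (count (X? ∘ suc)) (n≤1+n _)))
... | yes _ | no  _ | yes _ = s≤s ih
... | no  _ | yes _ | yes _ = ≤-trans (s≤s ih) (≤-reflexive (sym (+-suc _ _)))
... | x     | y     | no  _ = ≤-trans ih (+-mono-≤ (m≤n+m _ (bit x)) (m≤n+m _ (bit y)))

count-mono : ∀ {m} {X Y : Pred (Fin m) 0ℓ} (X? : Decidable X) (Y? : Decidable Y) →
             (∀ i → X i → Y i) → count X? ≤ count Y?
count-mono X? Y? X⇒Y = begin
  count X?             ≤⟨ count-∪ Y? ∅? X? (λ i ¬y x → ¬y (X⇒Y i x)) ⟩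
  count Y? + count ∅?  ≡⟨ cong (count Y? +_) (count-empty ∅? λ _ ()) ⟩
  count Y? + 0         ≡⟨ +-identityʳ _ ⟩
  count Y?             ∎
  where
  open ≤-Reasoning
  ∅? : Decidable {A = Fin _} (λ _ → ⊥)
  ∅? _ = no λ ()

injection⇒≤count : ∀ {a m} {X : Pred (Fin m) 0ℓ} (X? : Decidable X) (f : Fin a → Fin m) →
                   Injective _≡_ _≡_ f → (∀ i → X (f i)) → a ≤ count X?
injection⇒≤count {a} {m} X? f f-inj Xf =
  subst (a ≤_) (length-filter-allFin X?) (injective⇒≤ {f = Any.index ∘ member} λ {i} {j} eq →
    f-inj (Membership.index-injective (setoid (Fin m)) (member i) (member j) eq))
  where
  member : ∀ i → f i ∈ filter X? (allFin m)
  member i = ∈-filter⁺ X? (∈-allFin (f i)) (Xf i)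

lookup-injective : ∀ {A : Set} {xs : List A} → Unique xs → Injective _≡_ _≡_ (lookup xs)
lookup-injective (_ ∷ _)  {zero}  {zero}  _  = refl
lookup-injective (x ∷ _)  {zero}  {suc j} eq = contradiction eq (All.lookup x (∈-lookup j))
lookup-injective (x ∷ _)  {suc i} {zero}  eq = contradiction (sym eq) (All.lookup x (∈-lookup i))
lookup-injective (_ ∷ xs) {suc i} {suc j} eq = cong suc (lookup-injective xs eq)

enumerate : ∀ {m} {X : Pred (Fin m) 0ℓ} (X? : Decidable X) →
            Σ (Fin (count X?) → Σ (Fin m) X) λ f → Injective _≡_ _≡_ (proj₁ ∘ f)
enumerate {m} {X} X? =
  subst (λ a → Σ (Fin a → Σ (Fin m) X) λ f → Injective _≡_ _≡_ (proj₁ ∘ f)) (length-filter-allFin X?)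
    ((λ i → lookup xs i , proj₂ (∈-filter⁻ X? {xs = allFin m} (∈-lookup i))) ,
     lookup-injective (Unique.filter⁺ X? (Unique.allFin⁺ m)))
  where
  xs : List (Fin m)
  xs = filter X? (allFin m)

-- Induction on `K` over the elements of class below `K`: each step adds a single class, hence at
-- most `B` elements.
count-by-class : ∀ {m k B} {X : Pred (Fin m) 0ℓ} (X? : Decidable X) (c : Fin m → Fin k) →
                 (∀ j → count (λ e → X? e ×-dec (c e ≟ j)) ≤ B) → count X? ≤ k * B
count-by-class {m} {k} {B} {X} X? c bound =
  ≤-trans (count-mono X? (below? k) (λ e x → x , toℕ<n (c e))) (below k ≤-refl)
  where
  below? : ∀ K → Decidable (λ e → X e × toℕ (c e) < K)
  below? K e = X? e ×-dec (toℕ (c e) <? K)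

  below : ∀ K → K ≤ k → count (below? K) ≤ K * B
  below zero    _   = ≤-reflexive (count-empty (below? 0) λ { _ (_ , ()) })
  below (suc K) K<k = ≤-trans
    (count-∪ (λ e → X? e ×-dec (c e ≟ fromℕ< K<k)) (below? K) (below? (suc K)) split)
    (+-mono-≤ (bound (fromℕ< K<k)) (below K (<⇒≤ K<k)))
    where
    split : ∀ e → ¬ (X e × c e ≡ fromℕ< K<k) → X e × toℕ (c e) < suc K → X e × toℕ (c e) < K
    split e other (x , c<) with m<1+n⇒m<n∨m≡n c<
    ... | inj₁ c<K = x , c<K
    ... | inj₂ c≡K = contradiction (x , toℕ-injective (trans c≡K (sym (toℕ-fromℕ< K<k)))) other

-- Rado's theorem

-- The search fixes the values one at a time. The function it rebuilds agrees with a given one only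
-- pointwise, so `P` must respect pointwise equality.
anyFunction? : ∀ {n r} {P : (Fin n → Fin r) → Set} →
               (∀ {f g} → (∀ i → f i ≡ g i) → P f → P g) → (∀ f → Dec (P f)) → Dec (∃ P)
anyFunction? {zero}  resp P? =
  map′ (λ p → Vector.[] , p) (λ (f , p) → resp (λ ()) p) (P? Vector.[])
anyFunction? {suc n} {r} {P} resp P? =
  map′ (λ (b , f , p) → b Vector.∷ f , p)
       (λ (f , p) → f zero , f ∘ suc , resp (λ { zero → refl ; (suc i) → refl }) p)
       (any? λ b → anyFunction? {P = λ f → P (b Vector.∷ f)}
         (λ f≗g → resp λ { zero → refl ; (suc i) → f≗g i }) (λ f → P? (b Vector.∷ f)))

-- The matroid is the graphic one on `N` vertices; `X e` is the type of candidates for the index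
-- `e`, each of which stands for an edge.
module Rado {N m : ℕ} {X : Fin m → Set} (ends : ∀ {e} → X e → Fin N × Fin N) where

  Contracts : ∀ {r} → (Fin N → Fin r) → ∀ {e} → X e → Set
  Contracts p x = p (proj₁ (ends x)) ≡ p (proj₂ (ends x))

  Family : Set
  Family = ∀ e → List (X e)

  inside? : ∀ {r} (A : Family) (p : Fin N → Fin r) → Decidable (λ e → All (Contracts p) (A e))
  inside? A p e = All.all? (λ x → p (proj₁ (ends x)) ≟ p (proj₂ (ends x))) (A e)

  inside : ∀ {r} → Family → (Fin N → Fin r) → ℕ
  inside A p = count (inside? A p)

  -- The edges inside the parts of `p` form a flat of rank `N - r`, so this is Rado's condition
  -- tested on flats: at most `N - r` of the candidate sets lie in one. The additive form avoids
  -- truncated subtraction.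
  Hall : Family → Set
  Hall A = ∀ {r} (p : Fin N → Fin r) → IsPartition p → inside A p + r ≤ N

  inside-mono : ∀ {r s A B} {p : Fin N → Fin r} {q : Fin N → Fin s} →
                (∀ e → All (Contracts p) (A e) → All (Contracts q) (B e)) →
                inside A p ≤ inside B q
  inside-mono {A = A} {B} {p} {q} = count-mono (inside? A p) (inside? B q)

  Hall-mono : ∀ {A B} →
              (∀ {r} (p : Fin N → Fin r) e → All (Contracts p) (B e) → All (Contracts p) (A e)) →
              Hall A → Hall B
  Hall-mono {A} {B} B⇒A hall {r} p onto =
    ≤-trans (+-monoˡ-≤ r (inside-mono {A = B} {A} {p} {p} (B⇒A p))) (hall p onto)

  -- The bound on `r` makes the search for a violation finite; it excludes nothing, since a
  -- partition of `N` points has at most `N` parts.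
  Violation : Family → Set
  Violation A = ∃ λ r → r < suc N × ∃ λ (p : Fin N → Fin r) → IsPartition p × N < inside A p + r

  violation? : ∀ A → Dec (Violation A)
  violation? A = anyUpTo? (λ r → anyFunction? {r = r} resp (λ p →
      all? (λ b → any? (λ u → p u ≟ b)) ×-dec (N <? inside A p + r))) (suc N)
    where
    resp : ∀ {r} {p q : Fin N → Fin r} → (∀ i → p i ≡ q i) →
           IsPartition p × N < inside A p + r → IsPartition q × N < inside A q + r
    resp {r} {p} {q} p≗q (onto , N<) =
      (λ b → proj₁ (onto b) , trans (sym (p≗q _)) (proj₂ (onto b))) ,
      ≤-trans N< (+-monoˡ-≤ r (inside-mono {A = A} {A} {p} {q} λ e →
        All.map λ eq → trans (sym (p≗q _)) (trans eq (p≗q _))))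

  ¬violation⇒Hall : ∀ {A} → ¬ Violation A → Hall A
  ¬violation⇒Hall ¬v {r} p onto = ≮⇒≥ λ N< →
    ¬v (r , s≤s (coarser⇒fewerParts id p onto (cong p)) , p , onto , N<)

  _[_≔_] : Family → ∀ e → List (X e) → Family
  (A [ e ≔ xs ]) i with e ≟ i
  ... | yes refl = xs
  ... | no  _    = A i

  update-same : ∀ A e {xs} → (A [ e ≔ xs ]) e ≡ xs
  update-same A e with e ≟ e
  ... | yes refl = refl
  ... | no  e≢e  = contradiction refl e≢e

  update-other : ∀ A {e i xs} → i ≢ e → (A [ e ≔ xs ]) i ≡ A i
  update-other A {e} {i} i≢e with e ≟ i
  ... | yes refl = contradiction refl i≢e
  ... | no  _    = refl

  -- Hall bounds the join and the meet of the two violated partitions by 2N in total,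
  -- whereas semimodularity and the two violations give at least 2N + 1.
  exchange : ∀ A e {x y zs} → Hall (A [ e ≔ x ∷ y ∷ zs ]) →
             Violation (A [ e ≔ x ∷ zs ]) → ¬ Violation (A [ e ≔ y ∷ zs ])
  exchange A e {x} {y} {zs} hall (a , _ , p , p-onto , N<p) (b , _ , q , q-onto , N<q)
    with meet p q
  ... | c , h , h-onto , h⊑p , h⊑q , pq⇒h
    with semimodular c ≤-refl p p-onto q q-onto h h-onto h⊑p h⊑q
  ... | d , j , j-onto , p⊑j , q⊑j , a+b≤c+d = <-irrefl refl (begin
      suc (suc (N + N))                          ≡⟨ cong suc (+-suc N N) ⟨
      suc N + suc N                              ≤⟨ +-mono-≤ N<p N<q ⟩
      (inside A₁ p + a) + (inside A₂ q + b)      ≤⟨ +-mono-interchange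
                                                      (inside A₁ p) a (inside A₂ q) b
                                                      (suc (inside A₀ j)) d (inside A₀ h) c
                                                      counts (≤-trans a+b≤c+d (≤-reflexive (+-comm c d))) ⟩
      suc ((inside A₀ j + d) + (inside A₀ h + c)) ≤⟨ s≤s (+-mono-≤ (hall j j-onto) (hall h h-onto)) ⟩
      suc (N + N)                                ∎)
    where
    open ≤-Reasoning
    A₀ A₁ A₂ : Family
    A₀ = A [ e ≔ x ∷ y ∷ zs ]
    A₁ = A [ e ≔ x ∷ zs ]
    A₂ = A [ e ≔ y ∷ zs ]

    transport : ∀ {r s} {f : Fin N → Fin r} {g : Fin N → Fin s} → f ⊑ g → ∀ {xs ys} i → i ≢ e →
                All (Contracts f) ((A [ e ≔ xs ]) i) → All (Contracts g) ((A [ e ≔ ys ]) i)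
    transport {f = f} {g} f⊑g {xs} {ys} i i≢e =
      subst (All (Contracts g)) (trans (update-other A i≢e) (sym (update-other A i≢e))) ∘ All.map (λ eq → f⊑g eq)

    counts : inside A₁ p + inside A₂ q ≤ suc (inside A₀ j + inside A₀ h)
    counts = count-exchange (inside? A₁ p) (inside? A₂ q) (inside? A₀ j) (inside? A₀ h) e
      (transport {f = p} {g = j} p⊑j) (transport {f = q} {g = j} q⊑j)
      (λ i i≢e P Q → subst (All (Contracts h)) (sym (update-other A i≢e))
         (All.zipWith (λ (eq , eq′) → pq⇒h eq eq′)
           (subst (All (Contracts p)) (update-other A i≢e) P ,
            subst (All (Contracts q)) (update-other A i≢e) Q)))
      -- At `e` only `p` is known to contract `x` and only `q` to contract `y`, so the join
      -- contracts the full list while the meet may fail to.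
      λ P Q → subst (All (Contracts j)) (sym (update-same A e))
         (at-e (subst (All (Contracts p)) (update-same A e) P)
               (subst (All (Contracts q)) (update-same A e) Q))
      where
      at-e : All (Contracts p) (x ∷ zs) → All (Contracts q) (y ∷ zs) →
             All (Contracts j) (x ∷ y ∷ zs)
      at-e (px ∷ pzs) (qy ∷ _) = p⊑j px ∷ q⊑j qy ∷ All.map (λ eq → p⊑j eq) pzs

  -- An empty candidate list is vacuously inside the discrete partition, which already has `N`
  -- parts.
  ¬Hall-[] : ∀ A e → ¬ Hall (A [ e ≔ [] ])
  ¬Hall-[] A e hall = <-irrefl refl (≤-trans
    (+-monoˡ-≤ N (injection⇒≤count {1} (inside? (A [ e ≔ [] ]) id) (λ _ → e)
      (λ { {zero} {zero} _ → refl })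
      (λ _ → subst (All (Contracts id)) (sym (update-same A e)) [])))
    (hall id λ b → b , refl))

  -- One of the first two candidates can always be dropped: if dropping `y` creates a violation,
  -- then by `exchange` dropping `x` does not.
  reduceAt : ∀ A e x zs → Hall (A [ e ≔ x ∷ zs ]) → ∃ λ y → Hall (A [ e ≔ [ y ] ])
  reduceAt A e x []       hall = x , hall
  reduceAt A e x (y ∷ zs) hall with violation? (A [ e ≔ x ∷ zs ])
  ... | no ¬v = reduceAt A e x zs (¬violation⇒Hall ¬v)
  ... | yes v = reduceAt A e y zs (¬violation⇒Hall (exchange A e hall v))

  reduceToSingleton : ∀ A e xs → Hall (A [ e ≔ xs ]) → ∃ λ y → Hall (A [ e ≔ [ y ] ])
  reduceToSingleton A e []       hall = ⊥-elim (¬Hall-[] A e hall)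
  reduceToSingleton A e (x ∷ zs) hall = reduceAt A e x zs hall

  reduceAll : ∀ A → Hall A → ∀ es →
              Σ Family λ B → Hall B × (∀ {e} → e ∈ es → ∃ λ x → B e ≡ [ x ])
  reduceAll A hall []       = A , hall , λ ()
  reduceAll A hall (e ∷ es) with reduceAll A hall es
  ... | B , hallB , singletons
    -- The family `B [ e ≔ B e ]` agrees with `B` only index by index, so the condition is carried
    -- over by `Hall-mono`.
    with reduceToSingleton B e (B e) (Hall-mono (λ p → unchanged p) hallB)
    where
    unchanged : ∀ {r} (p : Fin N → Fin r) i →
                All (Contracts p) ((B [ e ≔ B e ]) i) → All (Contracts p) (B i)
    unchanged p i with e ≟ i
    ... | yes refl = id
    ... | no  _    = id
  ... | x , hallB′ = B [ e ≔ [ x ] ] , hallB′ , λ {i} → singletons′ i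
    where
    singletons′ : ∀ i → i ∈ e ∷ es → ∃ λ y → (B [ e ≔ [ x ] ]) i ≡ [ y ]
    singletons′ i i∈ with e ≟ i
    ... | yes refl = x , refl
    singletons′ i (here i≡e)   | no e≢i = contradiction (sym i≡e) e≢i
    singletons′ i (there i∈es) | no _   = singletons i∈es

  -- Independence of the transversal is expressed by the condition for singleton lists;
  -- `Hall⇒noCycle` turns it into acyclicity.
  rado : ∀ A → Hall A → Σ (∀ e → X e) λ t → Hall (λ e → [ t e ])
  rado A hall with reduceAll A hall (allFin m)
  ... | B , hallB , singletons = (λ e → proj₁ (singletons (∈-allFin e))) ,
    Hall-mono (λ p e → subst (All (Contracts p)) (sym (proj₂ (singletons (∈-allFin e))))) hallB

  -- Collapsing the `suc l` vertices of a cycle leaves at least `N - l` parts, yet `suc l` indices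
  -- have their edge inside a part, one more than the condition allows.
  Hall⇒noCycle : (t : ∀ e → X e) → Hall (λ e → [ t e ]) →
    ∀ l (w : Fin (suc (suc l)) → Fin N) (f : Fin (suc l) → Fin m) →
    w (fromℕ (suc l)) ≡ w zero → Injective _≡_ _≡_ f →
    (∀ i → Joins (ends (t (f i))) (w (inject₁ i)) (w (suc i))) → ⊥
  Hall⇒noCycle t hall l w f closed f-inj joins with collapse l (w ∘ inject₁)
  ... | r , p , onto , N≤l+r , same = <-irrefl refl (begin
      suc (l + r)                    ≤⟨ +-monoˡ-≤ r (injection⇒≤count (inside? (λ e → [ t e ]) p) f f-inj
                                          (λ i → contracted i (joins i) ∷ [])) ⟩
      inside (λ e → [ t e ]) p + r   ≤⟨ hall p onto ⟩
      N                              ≤⟨ N≤l+r ⟩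
      l + r                          ∎)
    where
    open ≤-Reasoning
    -- `collapse` treats all positions but the last, and the last vertex equals the first by
    -- `closed`.
    same′ : ∀ i → p (w i) ≡ p (w zero)
    same′ i with view i
    ... | ‵fromℕ     = cong p closed
    ... | ‵inject₁ j = same j
    contracted : ∀ i → Joins (ends (t (f i))) (w (inject₁ i)) (w (suc i)) → Contracts p (t (f i))
    contracted i (inj₁ (eq₁ , eq₂)) = trans (cong p eq₁) (trans (same i)
      (trans (sym (same′ (suc i))) (sym (cong p eq₂))))
    contracted i (inj₂ (eq₁ , eq₂)) = trans (cong p eq₁) (trans (same′ (suc i))
      (trans (sym (same i)) (sym (cong p eq₂))))

-- Forests

Joins-sym : ∀ {n} {e : Fin n × Fin n} {x y} → Joins e x y → Joins e y x
Joins-sym (inj₁ (a , b)) = inj₂ (a , b)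
Joins-sym (inj₂ (a , b)) = inj₁ (a , b)

Joins-end : ∀ {n} {e : Fin n × Fin n} {x y s t} → Joins e x y → Joins e s t → x ≡ s ⊎ x ≡ t
Joins-end (inj₁ (refl , refl)) (inj₁ (a , b)) = inj₁ a
Joins-end (inj₁ (refl , refl)) (inj₂ (a , b)) = inj₂ a
Joins-end (inj₂ (refl , refl)) (inj₁ (a , b)) = inj₂ b
Joins-end (inj₂ (refl , refl)) (inj₂ (a , b)) = inj₁ b

Adjacent : ∀ {a n} → (Fin a → Fin n × Fin n) → Rel (Fin n) 0ℓ
Adjacent g x y = ∃ λ i → Joins (g i) x y

Connected : ∀ {a n} → (Fin a → Fin n × Fin n) → Rel (Fin n) 0ℓ
Connected g = Star (Adjacent g)

Connected-isEquivalence : ∀ {a n} (g : Fin a → Fin n × Fin n) → IsEquivalence (Connected g)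
Connected-isEquivalence g = record
  { refl = ε ; sym = Star.reverse (λ (i , j) → i , Joins-sym j) ; trans = _◅◅_ }

data Walk {a n} (g : Fin a → Fin n × Fin n) : Fin n → Fin n → ℕ → Set where
  nil  : ∀ {x} → Walk g x x 0
  step : ∀ {x y z l} i → Joins (g i) x y → Walk g y z l → Walk g x z (suc l)

module _ {a n} {g : Fin a → Fin n × Fin n} where

  vertexAt : ∀ {x y l} → Walk g x y l → Fin (suc l) → Fin n
  vertexAt {x} _          zero    = x
  vertexAt     (step _ _ w) (suc i) = vertexAt w i

  edgeAt : ∀ {x y l} → Walk g x y l → Fin l → Fin a
  edgeAt (step i _ _) zero    = i
  edgeAt (step _ _ w) (suc i) = edgeAt w i

  vertexAt-last : ∀ {x y l} (w : Walk g x y l) → vertexAt w (fromℕ l) ≡ y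
  vertexAt-last nil          = refl
  vertexAt-last (step _ _ w) = vertexAt-last w

  walk-joins : ∀ {x y l} (w : Walk g x y l) i →
               Joins (g (edgeAt w i)) (vertexAt w (inject₁ i)) (vertexAt w (suc i))
  walk-joins (step _ j nil)          zero    = j
  walk-joins (step _ j (step _ _ _)) zero    = j
  walk-joins (step _ _ w)            (suc i) = walk-joins w i

  Simple : ∀ {x y l} → Walk g x y l → Set
  Simple nil              = ⊤
  Simple (step {x} _ _ w) = (∀ i → x ≢ vertexAt w i) × Simple w

  suffix : ∀ {x y l} (w : Walk g x y l) → Simple w → ∀ i →
           ∃ λ l′ → Σ (Walk g (vertexAt w i) y l′) Simple
  suffix w            s       zero    = _ , w , s
  suffix (step _ _ w) (_ , s) (suc i) = suffix w s i

  -- If the new starting vertex already occurs on the simple walk, only the suffix from that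
  -- occurrence is kept.
  simplify : ∀ {x y} → Connected g x y → ∃ λ l → Σ (Walk g x y l) Simple
  simplify ε = 0 , nil , tt
  simplify {x} ((i , j) ◅ c) with simplify c
  ... | l , w , s with any? (λ k → x ≟ vertexAt w k)
  ... | yes (k , refl) = suffix w s k
  ... | no  fresh      = suc l , step i j w , (λ k eq → fresh (k , eq)) , s

  vertexAt-injective : ∀ {x y l} (w : Walk g x y l) → Simple w → Injective _≡_ _≡_ (vertexAt w)
  vertexAt-injective w            s           {zero}  {zero}  _  = refl
  vertexAt-injective (step _ _ w) (fresh , _) {zero}  {suc j} eq = contradiction eq (fresh j)
  vertexAt-injective (step _ _ w) (fresh , _) {suc i} {zero}  eq = contradiction (sym eq) (fresh i)
  vertexAt-injective (step _ _ w) (_ , s)     {suc i} {suc j} eq = cong suc (vertexAt-injective w s eq)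

  -- Both ends of an edge of `w` lie on `w`, whereas `x` is an end of `i` and is not on `w`.
  edge-at-fresh-vertex : ∀ {x y z z′ l} (w : Walk g y z l) {i} → Joins (g i) x z′ →
                         (∀ k → x ≢ vertexAt w k) → ∀ k → i ≢ edgeAt w k
  edge-at-fresh-vertex w j fresh k refl with Joins-end j (walk-joins w k)
  ... | inj₁ eq = fresh (inject₁ k) eq
  ... | inj₂ eq = fresh (suc k) eq

  edgeAt-injective : ∀ {x y l} (w : Walk g x y l) → Simple w → Injective _≡_ _≡_ (edgeAt w)
  edgeAt-injective (step _ _ w) _           {zero}  {zero}  _  = refl
  edgeAt-injective (step _ j w) (fresh , _) {zero}  {suc i} eq =
    contradiction eq (edge-at-fresh-vertex w j fresh i)
  edgeAt-injective (step _ j w) (fresh , _) {suc i} {zero}  eq =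
    contradiction (sym eq) (edge-at-fresh-vertex w j fresh i)
  edgeAt-injective (step _ _ w) (_ , s)     {suc i} {suc j} eq = cong suc (edgeAt-injective w s eq)

-- A simple walk from `v` back to `u` through the other edges is preceded by the edge `f zero`. If
-- `u` and `v` coincide, this walk has length 0 and the cycle is a loop.
closeWalk : ∀ {n a} (M : Multigraph n) (f : Fin (suc a) → Edge M) → Injective _≡_ _≡_ f →
            ∀ {u v} → Joins (ends M (f zero)) u v → Connected (ends M ∘ f ∘ suc) v u → Cycle M
closeWalk {n} M f f-inj {u} {v} joins-uv conn with simplify conn
... | l , w , simple = record
  { l = l ; vert = vert ; edge = edge ; closed = vertexAt-last w
  ; vertDistinct = vertDistinct ; edgeDistinct = edgeDistinct ; joins = joins }
  where
  vert : Fin (suc (suc l)) → Fin n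
  vert zero    = u
  vert (suc i) = vertexAt w i
  edge : Fin (suc l) → Edge M
  edge zero    = f zero
  edge (suc i) = f (suc (edgeAt w i))
  -- The walk ends at `u` and is simple, so `u` occurs at its last position only.
  last≢ : ∀ i → u ≢ vertexAt w (inject₁ i)
  last≢ i eq =
    fromℕ≢inject₁ {i = i} (vertexAt-injective w simple (trans (vertexAt-last w) eq))
  vertDistinct : Injective _≡_ _≡_ (λ i → vert (inject₁ i))
  vertDistinct {zero}  {zero}  _  = refl
  vertDistinct {zero}  {suc j} eq = contradiction eq (last≢ j)
  vertDistinct {suc i} {zero}  eq = contradiction (sym eq) (last≢ i)
  vertDistinct {suc i} {suc j} eq = cong suc (inject₁-injective (vertexAt-injective w simple eq))
  edgeDistinct : Injective _≡_ _≡_ edge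
  edgeDistinct {zero}  {zero}  _  = refl
  edgeDistinct {zero}  {suc j} eq = contradiction (f-inj eq) λ ()
  edgeDistinct {suc i} {zero}  eq = contradiction (f-inj eq) λ ()
  edgeDistinct {suc i} {suc j} eq = cong suc (edgeAt-injective w simple (suc-injective (f-inj eq)))
  joins : ∀ i → Joins (ends M (edge i)) (vert (inject₁ i)) (vert (suc i))
  joins zero    = joins-uv
  joins (suc i) = walk-joins w i

-- The edges are added one by one. Each must join two different parts, because inside a connected
-- part it would close a cycle; so each lowers the number of parts by one.
forest-components : ∀ {n} (M : Multigraph n) → Forest M →
  ∀ a (f : Fin a → Edge M) → Injective _≡_ _≡_ f →
  ∃₂ λ r (p : Fin n → Fin r) → IsPartition p × a + r ≤ n ×
    (∀ {x y} → p x ≡ p y → Connected (ends M ∘ f) x y)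
forest-components {n} M acyclic zero f f-inj = n , id , (λ b → b , refl) , ≤-refl , λ { refl → ε }
forest-components {n} M acyclic (suc a) f f-inj
  with forest-components M acyclic a (f ∘ suc) (λ eq → suc-injective (f-inj eq))
... | r , p , onto , a+r≤n , connected with p (proj₁ (ends M (f zero))) ≟ p (proj₂ (ends M (f zero)))
... | yes eq = contradiction (closeWalk M f f-inj (inj₁ (refl , refl)) (connected (sym eq))) acyclic
... | no neq = q.size , q.label , q.partition ,
  ≤-trans (≤-reflexive (sym (+-suc a q.size))) (≤-trans (+-monoʳ-≤ a (q.size< neq)) a+r≤n) ,
  q.finest (Connected-isEquivalence (ends M ∘ f))
    (λ eq → Star.map (λ (i , j) → suc i , j) (connected eq))
    ((zero , inj₁ (refl , refl)) ◅ ε)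
  where module q = Merge (merge p onto (proj₁ (ends M (f zero))) (proj₂ (ends M (f zero))))

-- The components of the chosen edges refine `p`, so there are at least `r` of them.
forest-edges-within-parts : ∀ {n r a} (M : Multigraph n) → Forest M →
  (f : Fin a → Edge M) → Injective _≡_ _≡_ f →
  (p : Fin n → Fin r) → IsPartition p →
  (∀ i → p (proj₁ (ends M (f i))) ≡ p (proj₂ (ends M (f i)))) → a + r ≤ n
forest-edges-within-parts {n} {r} {a} M acyclic f f-inj p onto within
  with forest-components M acyclic a f f-inj
... | s , q , _ , a+s≤n , connected =
  ≤-trans (+-monoʳ-≤ a (coarser⇒fewerParts q p onto (same-part ∘ connected))) a+s≤n
  where
  along : ∀ i {x y} → Joins (ends M (f i)) x y → p x ≡ p y
  along i (inj₁ (refl , refl)) = within i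
  along i (inj₂ (refl , refl)) = sym (within i)
  same-part : ∀ {x y} → Connected (ends M ∘ f) x y → p x ≡ p y
  same-part = Star.fold (λ x y → p x ≡ p y) (λ (i , j) → trans (along i j)) refl


-- Hedgegraphs

trimmedEnds : ∀ {n} {hs : List (Hyperedge n)} → Trimming hs → Fin n × Fin n
trimmedEnds t = proj₁ (proj₂ (proj₂ t))

uncrossed-trimming : ∀ {n r} (p : Fin n → Fin r) {hs : List (Hyperedge n)} → ¬ Any (Crosses p) hs →
                     ∀ t → p (proj₁ (trimmedEnds {hs = hs} t)) ≡ p (proj₂ (trimmedEnds {hs = hs} t))
uncrossed-trimming p uncrossed (h , h∈ , (u , v) , _ , u∈ , v∈) =
  decidable-stable (p u ≟ p v) λ neq → uncrossed (lose h∈ (u , v , u∈ , v∈ , neq))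

-- The uncrossed hedges of one class are trimmed to forest edges inside the parts, so each of the
-- `k` classes contributes at most `n ∸ r`.
partitionable⇒bound : ∀ {n m} (G : Hedgegraph n m) (k : ℕ) → PartitionableInto G k →
  ∀ r (p : Fin n → Fin r) → IsPartition p → sizeEP G p ≤ k * (n ∸ r)
partitionable⇒bound {n} {m} G k (c , classes) r p onto =
  subst (_≤ k * (n ∸ r)) (sym (length-filter-allFin uncrossed?))
    (count-by-class uncrossed? c λ j → m+n≤o⇒m≤o∸n _ (class-bound j))
  where
  uncrossed? : Decidable (λ e → ¬ InDelta G p e)
  uncrossed? e = ¬? (inDelta? G p e)

  class-bound : ∀ j → count (λ e → uncrossed? e ×-dec (c e ≟ j)) + r ≤ n
  class-bound j with enumerate (λ e → uncrossed? e ×-dec (c e ≟ j))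
  ... | f , f-inj = forest-edges-within-parts
    (trimmed G (λ e → c e ≡ j) (proj₁ (classes j))) (proj₂ (classes j))
    (λ i → proj₁ (f i) , proj₂ (proj₂ (f i)))
    (λ eq → f-inj (cong proj₁ eq)) p onto
    (λ i → uncrossed-trimming p (proj₁ (proj₂ (f i)))
      (proj₁ (classes j) _ (proj₂ (proj₂ (f i)))))

-- Enumeration of the trimmings of a hedge

fromDec : {P : Set} → Dec P → List P
fromDec (yes p) = [ p ]
fromDec (no  _) = []

-- The listed proof need not be the given one, so membership is claimed for some proof only.
∈-fromDec : {P : Set} (d : Dec P) → P → ∃ (_∈ fromDec d)
∈-fromDec (yes p) _ = p , here refl
∈-fromDec (no ¬p) p = contradiction p ¬p

trimmingsAt : ∀ {n} {hs : List (Hyperedge n)} (h : Hyperedge n) → h ∈ hs → List (Trimming hs)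
trimmingsAt {n} h h∈ = concatMap (λ u → concatMap (λ v →
  map (λ proper → h , h∈ , (u , v) , proper)
      (fromDec (¬? (u ≟ v) ×-dec ((u ∈? h) ×-dec (v ∈? h)))))
  (allFin n)) (allFin n)

weakenTrimming : ∀ {n h} {hs : List (Hyperedge n)} → Trimming hs → Trimming (h ∷ hs)
weakenTrimming (h , h∈ , t) = h , there h∈ , t

trimmings : ∀ {n} (hs : List (Hyperedge n)) → List (Trimming hs)
trimmings []       = []
trimmings (h ∷ hs) = trimmingsAt h (here refl) ++ map weakenTrimming (trimmings hs)

-- Two vertices of a hyperedge with different labels are distinct, so this pair is among the listed
-- trimmings.
crossed-trimming : ∀ {n r} (p : Fin n → Fin r) (hs : List (Hyperedge n)) → Any (Crosses p) hs →
  ∃ λ t → t ∈ trimmings hs ×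
    p (proj₁ (trimmedEnds {hs = hs} t)) ≢ p (proj₂ (trimmedEnds {hs = hs} t))
crossed-trimming p (h ∷ hs) (here (u , v , u∈ , v∈ , neq))
  with ∈-fromDec (¬? (u ≟ v) ×-dec ((u ∈? h) ×-dec (v ∈? h))) (neq ∘ cong p , u∈ , v∈)
... | proper , proper∈ = (h , here refl , (u , v) , proper) ,
  ∈-++⁺ˡ (∈-concatMap⁺ _ (lose (∈-allFin u)
    (∈-concatMap⁺ _ (lose (∈-allFin v) (∈-map⁺ _ proper∈))))) , neq
crossed-trimming p (h ∷ hs) (there crossed) with crossed-trimming p hs crossed
... | t , t∈ , neq = weakenTrimming t ,
  ∈-++⁺ʳ (trimmingsAt h (here refl)) (∈-map⁺ weakenTrimming t∈) , neq

-- Disjoint copies of the vertex set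

argmax : ∀ {k} (f : Fin (suc k) → ℕ) → ∃ λ j → ∀ i → f i ≤ f j
argmax {zero}  f = zero , λ { zero → ≤-refl }
argmax {suc k} f with argmax (f ∘ suc)
... | j , max with ≤-total (f zero) (f (suc j))
... | inj₁ le = suc j , λ { zero → le ; (suc i) → max i }
... | inj₂ ge = zero , λ { zero → ≤-refl ; (suc i) → ≤-trans (max i) ge }

module _ {n m : ℕ} (G : Hedgegraph n m) (k : ℕ) where

  ColouredTrimming : Fin m → Set
  ColouredTrimming e = Fin k × Trimming (hedge G e)

  -- The vertex `x` of copy `j` is encoded as `combine j x`, so a colour is the copy in which the
  -- trimmed edge is placed.
  colouredEnds : ∀ {e} → ColouredTrimming e → Fin (k * n) × Fin (k * n)
  colouredEnds {e} (j , t) =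
    combine j (proj₁ (trimmedEnds {hs = hedge G e} t)) ,
    combine j (proj₂ (trimmedEnds {hs = hedge G e} t))

  open Rado {X = ColouredTrimming} colouredEnds

  colouredTrimmings : Family
  colouredTrimmings e = cartesianProduct (allFin k) (trimmings (hedge G e))

  -- A hedge crossed by `q` has a trimming with ends in different parts of `q`, and `p` does not
  -- contract its candidate in copy `j`.
  inside≤sizeEP : ∀ {r s} (p : Fin (k * n) → Fin r) (q : Fin n → Fin s) j →
                  (p ∘ combine j) ⊑ q → inside colouredTrimmings p ≤ sizeEP G q
  inside≤sizeEP p q j pⱼ⊑q = subst (inside colouredTrimmings p ≤_)
    (sym (length-filter-allFin (λ e → ¬? (inDelta? G q e))))
    (count-mono (inside? colouredTrimmings p) (λ e → ¬? (inDelta? G q e))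
     λ e contracted crossed →
      let t , t∈ , neq = crossed-trimming q (hedge G e) crossed
      in neq (pⱼ⊑q (All.lookup contracted (∈-cartesianProduct⁺ (∈-allFin j) t∈))))

  -- A part of `p` is determined by a copy that it meets together with a part of `q` in that copy;
  -- there are at most `k * R` such pairs.
  size≤ : ∀ {r} (p : Fin (k * n) → Fin r) → IsPartition p →
          ∀ R → (s : Fin k → ℕ) → (∀ j → s j ≤ R) → (q : ∀ j → Fin n → Fin (s j)) →
          (∀ j → q j ⊑ (p ∘ combine j)) → r ≤ k * R
  size≤ {r} p onto R s s≤R q q⊑pⱼ = injective⇒≤ {f = f} f-inj
    where
    copy : Fin r → Fin k
    copy b = proj₁ (combine-surjective (proj₁ (onto b)))
    vertex : Fin r → Fin n
    vertex b = proj₁ (proj₂ (combine-surjective {k} (proj₁ (onto b))))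
    vertex-in : ∀ b → p (combine (copy b) (vertex b)) ≡ b
    vertex-in b = trans
      (cong p (proj₂ (proj₂ (combine-surjective {k} (proj₁ (onto b))))))
      (proj₂ (onto b))
    label : ∀ j → Fin n → Fin R
    label j x = inject≤ (q j x) (s≤R j)
    f : Fin r → Fin (k * R)
    f b = combine (copy b) (label (copy b) (vertex b))
    same-label : ∀ {j j′ x x′} → j ≡ j′ → label j x ≡ label j′ x′ →
                 p (combine j x) ≡ p (combine j′ x′)
    same-label {j} refl eq = q⊑pⱼ j (inject≤-injective (s≤R j) (s≤R j) _ _ eq)
    f-inj : Injective _≡_ _≡_ f
    f-inj {b} {b′} eq = trans (sym (vertex-in b)) (trans
      (same-label (combine-injectiveˡ (copy b) _ (copy b′) _ eq)
                  (combine-injectiveʳ (copy b) _ (copy b′) _ eq))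
      (vertex-in b′))

  -- The class of a hedge is the copy holding its chosen edge, so a cycle in class `j` lifts to a
  -- cycle in copy `j`.
  Hall⇒partitionable : Hall colouredTrimmings → PartitionableInto G k
  Hall⇒partitionable hall with rado colouredTrimmings hall
  ... | t , hall-t = proj₁ ∘ t , λ j → (λ e _ → proj₂ (t e)) , acyclic j
    where
    in-copy : ∀ {j e x y} → proj₁ (t e) ≡ j →
              Joins (trimmedEnds {hs = hedge G e} (proj₂ (t e))) x y →
              Joins (colouredEnds (t e)) (combine j x) (combine j y)
    in-copy refl (inj₁ (refl , refl)) = inj₁ (refl , refl)
    in-copy refl (inj₂ (refl , refl)) = inj₂ (refl , refl)

    acyclic : ∀ j → Forest (trimmed G (λ e → proj₁ (t e) ≡ j) (λ e _ → proj₂ (t e)))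
    acyclic j C = Hall⇒noCycle t hall-t C.l
      (combine j ∘ C.vert) (proj₁ ∘ C.edge) (cong (combine j) C.closed)
      (λ eq → C.edgeDistinct (same-edge eq))
      (λ i → in-copy (proj₂ (C.edge i)) (C.joins i))
      where
      module C = Cycle C
      -- An edge of the class is a hedge with a proof of its colour. Such proofs are unique, so
      -- distinct edges come from distinct hedges.
      same-edge : ∀ {x y : Σ (Fin m) λ e → proj₁ (t e) ≡ j} → proj₁ x ≡ proj₁ y → x ≡ y
      same-edge {_ , refl} {_ , refl} refl = refl

-- Let copy `j` have the most induced parts. The hypothesis for `q j` bounds the hedges inside by
-- `suc k * (n ∸ s j)`, maximality bounds the parts of `p` by `suc k * s j`, and the sum is
-- `suc k * n`. Writing the number of copies as `suc k` ensures that a maximum exists.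
bound⇒Hall : ∀ {n m} (G : Hedgegraph n m) k →
  (∀ r (p : Fin n → Fin r) → IsPartition p → sizeEP G p ≤ suc k * (n ∸ r)) →
  Rado.Hall (colouredEnds G (suc k)) (colouredTrimmings G (suc k))
bound⇒Hall {n} G k bound {r} p onto = begin
  inside p + r                    ≤⟨ +-mono-≤
                                       (≤-trans (inside≤sizeEP G (suc k) p (q j) j (p⊑q j))
                                                (bound (s j) (q j) (q-onto j)))
                                       (size≤ G (suc k) p onto (s j) s max q q⊑p) ⟩
  suc k * (n ∸ s j) + suc k * s j ≡⟨ *-distribˡ-+ (suc k) (n ∸ s j) (s j) ⟨
  suc k * ((n ∸ s j) + s j)       ≡⟨ cong (suc k *_) (m∸n+n≡m s≤n) ⟩
  suc k * n                       ∎
  where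
  open ≤-Reasoning
  inside : ∀ {r} → (Fin (suc k * n) → Fin r) → ℕ
  inside = Rado.inside (colouredEnds G (suc k)) (colouredTrimmings G (suc k))
  s : Fin (suc k) → ℕ
  s i = proj₁ (quotient (p ∘ combine i))
  q : ∀ i → Fin n → Fin (s i)
  q i = proj₁ (proj₂ (quotient (p ∘ combine i)))
  q-onto : ∀ i → IsPartition (q i)
  q-onto i = proj₁ (proj₂ (proj₂ (quotient (p ∘ combine i))))
  p⊑q : ∀ i → (p ∘ combine i) ⊑ q i
  p⊑q i = proj₁ (proj₂ (proj₂ (proj₂ (quotient (p ∘ combine i)))))
  q⊑p : ∀ i → q i ⊑ (p ∘ combine i)
  q⊑p i = proj₂ (proj₂ (proj₂ (proj₂ (quotient (p ∘ combine i)))))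
  j : Fin (suc k)
  j = proj₁ (argmax s)
  max : ∀ i → s i ≤ s j
  max = proj₂ (argmax s)
  s≤n : s j ≤ n
  s≤n = coarser⇒fewerParts id (q j) (q-onto j) (cong (q j))

theorem1p4 : ∀ {n m} (G : Hedgegraph n m) (k : ℕ) → 1 ≤ k →
    PartitionableInto G k ⇔
    (∀ (r : ℕ) (p : Fin n → Fin r) → IsPartition p → sizeEP G p ≤ k * (n ∸ r))
theorem1p4 G (suc k) _ = mk⇔ (partitionable⇒bound G (suc k))
  (λ bound → Hall⇒partitionable G (suc k) (bound⇒Hall G k bound))
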